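{- Let $n\ge m\ge 1$ be integers and let $\varphi(n,m)$ be the number of optimal solutions of the shifting-checkers game with $n$ black and $m$ white checkers, i.e. the number of distinct shortest paths from the initial configuration to the final configuration in the state space graph of the game. Then $$\varphi(n,m)=\begin{cases}\frac{1}{\sqrt5}\left(\left(\frac{1+\sqrt5}{2}\right)^{n+2}-\left(\frac{1-\sqrt5}{2}\right)^{n+2}\right)=F_{n+2} & n\ge m=1,\\ 2 & n\ge m>1,\end{cases}$$ where $F_k$ denotes the $k$-th Fibonacci number ($F_1=F_2=1$).
   Context: The game: positions $1,\dots,n+m+1$ in a row, each holding a black checker ($b$), a white checker ($w$) or nothing, with exactly one empty position (the vacancy $O$). Initial configuration $b^nOw^m$, final configuration $w^mOb^n$. A legal move is a slide (a checker adjacent to the vacancy moves into it) or a jump (a checker at distance two from the vacancy jumps over the checker between them into it), in either direction. The state space graph has the configurations as vertices, with an edge from one configuration to another if a single legal move transforms the first into the second. An optimal solution is a shortest path from the initial to the final configuration in this graph (its length is $nm+n+m$). -}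

module Defs where

open import Data.Integer.Base using (+_)
open import Data.List.Base using (List; []; _∷_; _++_; filter; head; last; length; replicate)
open import Data.List.Membership.Propositional using (_∈_)
open import Data.List.Properties using (filter-++; filter-all; filter-none; length-++; length-replicate)
open import Data.List.Relation.Unary.All.Properties using (replicate⁺)
open import Data.List.Relation.Unary.Linked using (Linked)
open import Data.List.Relation.Unary.Unique.Propositional using (Unique)
open import Data.Maybe.Base using (just)
open import Data.Nat.Base as ℕ using (ℕ; zero; suc; pred; _≤_)
open import Data.Nat.Properties using (+-identityʳ)
open import Data.Product.Base using (_×_; ∃-syntax)
open import Data.Rational.Base as ℚ using (ℚ; 0ℚ; 1ℚ)
open import Function.Bundles using (_⇔_)
open import Relation.Binary.Definitions using (DecidableEquality)
open import Relation.Binary.PropositionalEquality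
open import Relation.Nullary.Decidable using (yes; no)

data Colour : Set where
  black white : Colour

data Cell : Set where
  checker : Colour → Cell
  O       : Cell

pattern b = checker black
pattern w = checker white

_≟_ : DecidableEquality Cell
b ≟ b = yes refl
b ≟ w = no λ ()
b ≟ O = no λ ()
w ≟ b = no λ ()
w ≟ w = yes refl
w ≟ O = no λ ()
O ≟ b = no λ ()
O ≟ w = no λ ()
O ≟ O = yes refl

count : Cell → List Cell → ℕ
count c row = length (filter (c ≟_) row)

-- The three counts force the row to have n + m + 1 positions.  They are
-- irrelevant, so configurations are equal as soon as their rows are.
record Configuration (n m : ℕ) : Set where
  constructor configuration
  field
    row        : List Cell
    .blacks    : count b row ≡ n
    .whites    : count w row ≡ m
    .vacancies : count O row ≡ 1

open Configuration public using (row)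

private
  count-++ : ∀ c xs ys → count c (xs ++ ys) ≡ count c xs ℕ.+ count c ys
  count-++ c xs ys =
    trans (cong length (filter-++ (c ≟_) xs ys)) (length-++ (filter (c ≟_) xs))

  count-replicate : ∀ k c → count c (replicate k c) ≡ k
  count-replicate k c =
    trans (cong length (filter-all (c ≟_) (replicate⁺ k refl))) (length-replicate k)

  count-replicate-≢ : ∀ k {c d} → c ≢ d → count c (replicate k d) ≡ 0
  count-replicate-≢ k {c} c≢d = cong length (filter-none (c ≟_) (replicate⁺ k c≢d))

initial : ∀ n m → Configuration n m
initial n m = configuration (replicate n b ++ O ∷ replicate m w)
  (trans (count-++ b (replicate n b) _)
    (trans (cong₂ ℕ._+_ (count-replicate n b) (count-replicate-≢ m λ ())) (+-identityʳ n)))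
  (trans (count-++ w (replicate n b) _)
    (cong₂ ℕ._+_ (count-replicate-≢ n λ ()) (count-replicate m w)))
  (trans (count-++ O (replicate n b) _)
    (cong₂ ℕ._+_ (count-replicate-≢ n λ ()) (cong suc (count-replicate-≢ m λ ()))))

final : ∀ n m → Configuration n m
final n m = configuration (replicate m w ++ O ∷ replicate n b)
  (trans (count-++ b (replicate m w) _)
    (cong₂ ℕ._+_ (count-replicate-≢ m λ ()) (count-replicate n b)))
  (trans (count-++ w (replicate m w) _)
    (trans (cong₂ ℕ._+_ (count-replicate m w) (count-replicate-≢ n λ ())) (+-identityʳ m)))
  (trans (count-++ O (replicate m w) _)
    (cong₂ ℕ._+_ (count-replicate-≢ m λ ()) (cong suc (count-replicate-≢ n λ ()))))

-- A checker may jump over a checker of either colour.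
data Move : List Cell → List Cell → Set where
  slideʳ : ∀ xs c ys → Move (xs ++ checker c ∷ O ∷ ys) (xs ++ O ∷ checker c ∷ ys)
  slideˡ : ∀ xs c ys → Move (xs ++ O ∷ checker c ∷ ys) (xs ++ checker c ∷ O ∷ ys)
  jumpʳ  : ∀ xs c d ys → Move (xs ++ checker c ∷ checker d ∷ O ∷ ys)
                              (xs ++ O ∷ checker d ∷ checker c ∷ ys)
  jumpˡ  : ∀ xs c d ys → Move (xs ++ O ∷ checker d ∷ checker c ∷ ys)
                              (xs ++ checker c ∷ checker d ∷ O ∷ ys)

Edge : ∀ {n m} → Configuration n m → Configuration n m → Set
Edge x y = Move (row x) (row y)

edges : {V : Set} → List V → ℕ
edges vs = pred (length vs)

module _ {V : Set} (E : V → V → Set) where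

  -- Paths are given by their vertex sequences.
  record IsPath (s t : V) (vs : List V) : Set where
    field
      starts : head vs ≡ just s
      ends   : last vs ≡ just t
      steps  : Linked E vs

  IsShortestPath : V → V → List V → Set
  IsShortestPath s t p = IsPath s t p × (∀ q → IsPath s t q → edges p ≤ edges q)

IsOptimalSolution : ∀ n m → List (Configuration n m) → Set
IsOptimalSolution n m = IsShortestPath Edge (initial n m) (final n m)

HasCardinality : {A : Set} → (A → Set) → ℕ → Set
HasCardinality {A} P k =
  ∃[ xs ] Unique xs × (∀ (x : A) → x ∈ xs ⇔ P x) × length xs ≡ k

F : ℕ → ℕ
F 0             = 0
F 1             = 1
F (suc (suc k)) = F (suc k) ℕ.+ F k

infixl 6 _+√5·_

-- The subfield ℚ(√5) of ℝ, in which both sides of Binet's formula live: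
-- x +√5· y stands for the real number x + y√5.  As √5 is irrational,
-- componentwise equality is equality of real numbers.
record ℚ√5 : Set where
  constructor _+√5·_
  field
    re im : ℚ

infixl 6 _+_ _-_
infixl 7 _*_ _÷_
infixr 8 _^_

_+_ _-_ _*_ : ℚ√5 → ℚ√5 → ℚ√5
(x +√5· y) + (u +√5· v) = (x ℚ.+ u) +√5· (y ℚ.+ v)
(x +√5· y) - (u +√5· v) = (x ℚ.- u) +√5· (y ℚ.- v)
(x +√5· y) * (u +√5· v) =
  (x ℚ.* u ℚ.+ (+ 5 ℚ./ 1) ℚ.* (y ℚ.* v)) +√5· (x ℚ.* v ℚ.+ y ℚ.* u)

fromℕ : ℕ → ℚ√5
fromℕ k = (+ k ℚ./ 1) +√5· 0ℚ

√5 : ℚ√5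
√5 = 0ℚ +√5· 1ℚ

norm : ℚ√5 → ℚ
norm (x +√5· y) = x ℚ.* x ℚ.- (+ 5 ℚ./ 1) ℚ.* (y ℚ.* y)

-- Division by rationalising the denominator:
-- 1 / (u + v√5) = (u - v√5) / (u² - 5v²).
_÷_ : (x y : ℚ√5) → .{{ℚ.NonZero (norm y)}} → ℚ√5
x ÷ y@(u +√5· v) = x * ((u ℚ.÷ norm y) +√5· ((ℚ.- v) ℚ.÷ norm y))

_^_ : ℚ√5 → ℕ → ℚ√5
x ^ zero  = fromℕ 1
x ^ suc k = x * x ^ k

private
  √5-squared : √5 * √5 ≡ fromℕ 5
  √5-squared = refl

  √5-inverse : (fromℕ 1 ÷ √5) * √5 ≡ fromℕ 1
  √5-inverse = refl

  halves : ((fromℕ 1 + √5) ÷ fromℕ 2) * fromℕ 2 ≡ fromℕ 1 + √5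
  halves = refl

{-# OPTIONS --safe #-}

-- Read the row without its vacancy as a lattice path, with the vacancy as a
-- token on it: a slide, or a jump over a like checker, moves the token along the
-- path, whereas a jump over an unlike checker keeps the height of the token and
-- flips a corner of the path, i.e. one of the nm boxes between the initial and
-- the final path.  A box can only be flipped while the token is at its height.
-- Hence nm flips are needed, and n + m moves that change the height, since boxes
-- occur at all the heights strictly between those of the two end configurations.
-- In an optimal solution the heights are therefore visited once each; as a box
-- can be flipped only after the boxes below it, they are visited in order.  The
-- boxes of one height form a zigzag of the path, and flipping one of them makes
-- it impossible to return over it, so the token has to sweep the zigzag from one
-- end to the other and then slide up onto an end of the next zigzag.  With at
-- least two white checkers this leaves only the choice of the very first
-- slide; with one white checker every zigzag consists of a single box, both of
-- its nodes are ends, and the choices are counted by Fibonacci numbers.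
module Submission where

open import Defs
open import Algebra.Properties.CommutativeSemigroup using (x∙yz≈y∙xz)
open import Data.Empty using (⊥-elim)
open import Data.Integer.Base as ℤ using (+_)
import Data.Integer.Properties as ℤ
open import Data.List.Base using (List; []; _∷_; _++_; _ʳ++_; filter; length; map; replicate; reverse)
open import Data.List.Membership.Propositional.Properties using (∈-map⁺; ∈-map⁻; ∈-++⁺ˡ; ∈-++⁺ʳ; ∈-++⁻)
open import Data.List.Properties using (filter-++; length-++; length-map; map-injective; map-replicate; reverse-injective; reverse-involutive; reverse-map; ʳ++-defn; ∷-injectiveˡ; ∷-injectiveʳ)
open import Data.List.Relation.Unary.All using ([])
open import Data.List.Relation.Unary.AllPairs using ([]; _∷_)
open import Data.List.Relation.Unary.Any using (here)
open import Data.List.Relation.Unary.Linked using ([-]; _∷_)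
import Data.List.Relation.Unary.Unique.Propositional.Properties as Unique
open import Data.Maybe.Properties using (just-injective)
open import Data.Nat.Base as ℕ using (ℕ; zero; suc; _≤_; _<_; _≥_; _>_; _⊔_; _⊓_; z≤n; s≤s)
open import Data.Nat.Properties hiding (_≟_)
open import Data.Product.Base using (_×_; _,_; proj₁; proj₂; ∃-syntax)
open import Data.Rational.Base as ℚ using (ℚ; ½; 0ℚ)
open import Data.Rational.Properties using (toℚᵘ-fromℚᵘ; toℚᵘ-homo-+; toℚᵘ-injective)
open import Data.Rational.Solver using (module +-*-Solver)
import Data.Rational.Unnormalised.Base as ℚᵘ
import Data.Rational.Unnormalised.Properties as ℚᵘ
open import Data.Sum.Base using (_⊎_; inj₁; inj₂; [_,_]′)
open import Function.Base using (_∘_; case_of_)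
open import Function.Bundles using (_⇔_; mk⇔; Equivalence)
open import Relation.Binary.PropositionalEquality using (_≡_; _≢_; refl; sym; trans; cong; cong₂; subst; module ≡-Reasoning)
open import Relation.Nullary.Negation using (¬_)

-- Lattice paths: inversions, depths of boxes and flips

pattern ● = black
pattern ○ = white

variable
  s s′ l r : List Colour

blacks whites inversions depth : List Colour → ℕ
blacks []      = 0
blacks (● ∷ s) = suc (blacks s)
blacks (○ ∷ s) = blacks s

whites []      = 0
whites (● ∷ s) = whites s
whites (○ ∷ s) = suc (whites s)

inversions []      = 0
inversions (● ∷ s) = whites s ℕ.+ inversions s
inversions (○ ∷ s) = inversions s

-- depth s is the largest depth of an unflipped box: the box of a black checker
-- and a white checker further right has depth p + q if p checkers are black up
-- to and including the former, and q are white strictly beyond the latter.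
raise : ℕ → ℕ → ℕ
raise zero    d = 0
raise (suc k) d = suc (d ⊔ k)

depth []      = 0
depth (● ∷ s) = raise (whites s) (depth s)
depth (○ ∷ s) = depth s

-- s′ arises from s by flipping a box of depth y.
record Flip (y : ℕ) (s s′ : List Colour) : Set where
  field
    {j}        : ℕ
    whitesˡ    : whites s ≡ suc j
    whitesʳ    : whites s′ ≡ suc j
    inversion  : inversions s ≡ suc (inversions s′)
    depth-⊔    : depth s ≡ depth s′ ⊔ y
    depth-drop : y ≤ suc (depth s′)

open Flip

raise-≥ : ∀ k d → k ≤ raise k d
raise-≥ zero    d = z≤n
raise-≥ (suc k) d = s≤s (m≤n⊔m d k)

depth-no-whites : ∀ s → whites s ≡ 0 → depth s ≡ 0
depth-no-whites []      _  = refl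
depth-no-whites (● ∷ s) eq rewrite eq = refl

flip-here : ∀ s → Flip (suc (whites s)) (● ∷ ○ ∷ s) (○ ∷ ● ∷ s)
flip-here s = record
  { whitesˡ    = refl
  ; whitesʳ    = refl
  ; inversion  = refl
  ; depth-⊔    = lemma (whites s) refl
  ; depth-drop = s≤s (raise-≥ (whites s) (depth s))
  }
  where
  lemma : ∀ k → whites s ≡ k → suc (depth s ⊔ k) ≡ raise k (depth s) ⊔ suc k
  lemma zero    eq rewrite depth-no-whites s eq = refl
  lemma (suc k) _  = cong suc (sym (trans (⊔-assoc (depth s) k (suc k))
                                          (cong (depth s ⊔_) (m≤n⇒m⊔n≡n (n≤1+n k)))))

-- A black checker in front deepens every box by one and adds boxes of its own, whose depths depend
-- only on the number of white checkers, which a flip preserves.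
flip-● : ∀ {y} → Flip y s s′ → Flip (suc y) (● ∷ s) (● ∷ s′)
flip-● {s} {s′} {y} f = record
  { whitesˡ    = whitesˡ f
  ; whitesʳ    = whitesʳ f
  ; inversion  = trans (cong₂ ℕ._+_ (trans (whitesˡ f) (sym (whitesʳ f))) (inversion f))
                       (+-suc (whites s′) (inversions s′))
  ; depth-⊔    = begin
      raise (whites s) (depth s)              ≡⟨ cong₂ raise (whitesˡ f) (depth-⊔ f) ⟩
      suc (depth s′ ⊔ y ⊔ j f)                ≡⟨ cong suc (⊔-assoc (depth s′) y (j f)) ⟩
      suc (depth s′ ⊔ (y ⊔ j f))              ≡⟨ cong (λ i → suc (depth s′ ⊔ i)) (⊔-comm y (j f)) ⟩
      suc (depth s′ ⊔ (j f ⊔ y))              ≡⟨ cong suc (⊔-assoc (depth s′) (j f) y) ⟨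
      raise (suc (j f)) (depth s′) ⊔ suc y    ≡⟨ cong (λ i → raise i (depth s′) ⊔ suc y) (sym (whitesʳ f)) ⟩
      raise (whites s′) (depth s′) ⊔ suc y    ∎
  ; depth-drop = subst (λ i → suc y ≤ suc (raise i (depth s′))) (sym (whitesʳ f))
                   (s≤s (≤-trans (depth-drop f) (s≤s (m≤m⊔n (depth s′) (j f)))))
  }
  where open ≡-Reasoning

flip-○ : ∀ {y} → Flip y s s′ → Flip y (○ ∷ s) (○ ∷ s′)
flip-○ f = record
  { whitesˡ    = cong suc (whitesˡ f)
  ; whitesʳ    = cong suc (whitesʳ f)
  ; inversion  = inversion f
  ; depth-⊔    = depth-⊔ f
  ; depth-drop = depth-drop f
  }

flip-≡ : ∀ {y y′} → y ≡ y′ → Flip y s s′ → Flip y′ s s′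
flip-≡ refl f = f

flip-ʳ++ : ∀ {y s s′} l → Flip y s s′ → Flip (blacks l ℕ.+ y) (l ʳ++ s) (l ʳ++ s′)
flip-ʳ++         []      f = f
flip-ʳ++ {y}     (● ∷ l) f = flip-≡ (+-suc (blacks l) y) (flip-ʳ++ l (flip-● f))
flip-ʳ++         (○ ∷ l) f = flip-ʳ++ l (flip-○ f)

flip : ∀ l r → Flip (blacks l ℕ.+ suc (whites r)) (l ʳ++ ● ∷ ○ ∷ r) (l ʳ++ ○ ∷ ● ∷ r)
flip l r = flip-ʳ++ l (flip-here r)

-- Zippers, the potential and the steps

-- The colours left of the vacancy, nearest first, and those right of it.
Zipper : Set
Zipper = List Colour × List Colour

whole : Zipper → List Colour
whole (l , r) = l ʳ++ r

-- The number of rows by which the vacancy is below its final height.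
level : Zipper → ℕ
level (l , r) = blacks l ℕ.+ whites r

-- The unflipped boxes occupy the depths 1, …, d.  The remaining changes of height
-- must visit these and depth 0, apart from the current depth y.
rows : ℕ → ℕ → ℕ
rows d y = d ⊔ (y ⊓ suc d)

-- `potential` bounds the number of moves left from below: one flip per inversion and one change of
-- height per row still to be visited. `liveLength` is the length of any sequence of `Advance` steps
-- to the goal.
potential liveLength : Zipper → ℕ
potential z = inversions (whole z) ℕ.+ rows (depth (whole z)) (level z)
liveLength z = inversions (whole z) ℕ.+ level z

data Step : Zipper → Zipper → Set where
  slideʳ : ∀ {c}   → Step (c ∷ l , r) (l , c ∷ r)
  slideˡ : ∀ {c}   → Step (l , c ∷ r) (c ∷ l , r)
  jumpʳ  : ∀ {c d} → Step (d ∷ c ∷ l , r) (l , d ∷ c ∷ r)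
  jumpˡ  : ∀ {c d} → Step (l , d ∷ c ∷ r) (d ∷ c ∷ l , r)

Cleared : Zipper → Set
Cleared z = depth (whole z) < level z

-- By `step-bound` only these steps can lower the potential: flips, and upward moves out of a row at
-- and below which every box is flipped.
data Tight : Zipper → Zipper → Set where
  flipʳ  : Tight (○ ∷ ● ∷ l , r) (l , ○ ∷ ● ∷ r)
  flipˡ  : Tight (l , ● ∷ ○ ∷ r) (● ∷ ○ ∷ l , r)
  slideʳ : Cleared (● ∷ l , r) → Tight (● ∷ l , r) (l , ● ∷ r)
  slideˡ : Cleared (l , ○ ∷ r) → Tight (l , ○ ∷ r) (○ ∷ l , r)
  jumpʳ  : Cleared (● ∷ ● ∷ l , r) → Tight (● ∷ ● ∷ l , r) (l , ● ∷ ● ∷ r)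
  jumpˡ  : Cleared (l , ○ ∷ ○ ∷ r) → Tight (l , ○ ∷ ○ ∷ r) (○ ∷ ○ ∷ l , r)

-- A step lowers the potential by at most one

rows-≤ : ∀ d y → rows d y ≤ suc d
rows-≤ d y = ⊔-lub (n≤1+n d) (m⊓n≤n y (suc d))

-- For fixed `d` the value of `rows` is `d` if `y ≤ d` and `suc d` otherwise, so it falls only by
-- passing from the second case to the first.
rows-tight : ∀ d y y′ → rows d y′ < rows d y → d < y × y′ ≤ d
rows-tight d y y′ lt =
    ≰⇒> (λ y≤d → <⇒≱ lt (≤-trans (⊔-lub ≤-refl (≤-trans (m⊓n≤m y _) y≤d)) (m≤m⊔n d _)))
  , ≮⇒≥ (λ d<y′ → <⇒≱ lt (≤-trans (rows-≤ d y) (≤-trans (⊓-glb d<y′ ≤-refl) (m≤n⊔m d _))))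

-- The current row is not among those still to be visited, so one more box in it adds nothing to
-- them.
rows-mono : ∀ d y → y ≤ suc d → rows (d ⊔ y) y ≤ rows d y
rows-mono d y y≤1+d = ⊔-lub (⊔-lub (m≤m⊔n d _) y≤rows) (≤-trans (m⊓n≤m y _) y≤rows)
  where
  y≤rows : y ≤ rows d y
  y≤rows = ≤-trans (⊓-glb ≤-refl y≤1+d) (m≤n⊔m d _)

TightBound : Zipper → Zipper → Set
TightBound z z′ = potential z ≤ suc (potential z′) × (potential z′ < potential z → Tight z z′)

level-bound : ∀ i d y y′ → i ℕ.+ rows d y ≤ suc (i ℕ.+ rows d y′)
level-bound i d y y′ =
  ≤-trans (+-monoʳ-≤ i (≤-trans (rows-≤ d y) (s≤s (m≤m⊔n d _)))) (≤-reflexive (+-suc i _))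

level-tight : ∀ i d y y′ → i ℕ.+ rows d y′ < i ℕ.+ rows d y → d < y × y′ ≤ d
level-tight i d y y′ lt = rows-tight d y y′ (+-cancelˡ-< i _ _ lt)

level-bound-up : ∀ z z′ → whole z ≡ whole z′ → (Cleared z → Tight z z′) → TightBound z z′
level-bound-up z z′ eq tight rewrite sym eq =
  level-bound i d y y′ , λ lt → tight (proj₁ (level-tight i d y y′ lt))
  where
  i = inversions (whole z)
  d = depth (whole z)
  y = level z
  y′ = level z′

level-bound-down : ∀ z z′ → whole z ≡ whole z′ → level z ≤ level z′ → TightBound z z′
level-bound-down z z′ eq le rewrite sym eq =
  level-bound i d y y′ , λ lt → let d<y , y′≤d = level-tight i d y y′ lt in
    ⊥-elim (<-irrefl refl (<-≤-trans d<y (≤-trans le y′≤d)))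
  where
  i = inversions (whole z)
  d = depth (whole z)
  y = level z
  y′ = level z′

flip-bound : ∀ z z′ → level z ≡ level z′ → Flip (level z) (whole z) (whole z′) → Tight z z′ →
             TightBound z z′
flip-bound z z′ eq f tight rewrite sym eq | inversion f | depth-⊔ f =
  s≤s (+-monoʳ-≤ (inversions (whole z′)) (rows-mono _ _ (depth-drop f))) , λ _ → tight

-- The restored box costs one inversion, and `rows` falls by at most one, so nothing is gained.
unflip-bound : ∀ z z′ → level z ≡ level z′ → Flip (level z) (whole z′) (whole z) → TightBound z z′
unflip-bound z z′ eq f rewrite sym eq | inversion f | depth-⊔ f =
  m≤n⇒m≤1+n le , λ gt → ⊥-elim (<⇒≱ gt le)
  where
  i = inversions (whole z)
  d = depth (whole z)
  y = level z
  le : i ℕ.+ rows d y ≤ suc i ℕ.+ rows (d ⊔ y) y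
  le = ≤-trans (+-monoʳ-≤ i (≤-trans (rows-≤ d y) (s≤s (≤-trans (m≤m⊔n d y) (m≤m⊔n (d ⊔ y) _)))))
               (≤-reflexive (+-suc i _))

level-○ : ∀ l r → blacks l ℕ.+ suc (whites r) ≡ suc (blacks l ℕ.+ whites r)
level-○ l r = +-suc (blacks l) (whites r)

step-bound : ∀ {z z′} → Step z z′ → TightBound z z′
step-bound (slideʳ {l} {r} {●}) =
  level-bound-up (● ∷ l , r) (l , ● ∷ r) refl slideʳ
step-bound (slideʳ {l} {r} {○}) =
  level-bound-down (○ ∷ l , r) (l , ○ ∷ r) refl (+-monoʳ-≤ (blacks l) (n≤1+n _))
step-bound (slideˡ {l} {r} {●}) =
  level-bound-down (l , ● ∷ r) (● ∷ l , r) refl (n≤1+n _)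
step-bound (slideˡ {l} {r} {○}) =
  level-bound-up (l , ○ ∷ r) (○ ∷ l , r) refl slideˡ
step-bound (jumpʳ {l} {r} {●} {●}) =
  level-bound-up (● ∷ ● ∷ l , r) (l , ● ∷ ● ∷ r) refl jumpʳ
step-bound (jumpʳ {l} {r} {○} {○}) =
  level-bound-down (○ ∷ ○ ∷ l , r) (l , ○ ∷ ○ ∷ r) refl (+-monoʳ-≤ (blacks l) (m≤n+m _ 2))
step-bound (jumpʳ {l} {r} {●} {○}) =
  flip-bound (○ ∷ ● ∷ l , r) (l , ○ ∷ ● ∷ r) (sym (level-○ l r))
  (flip-≡ (level-○ l r) (flip l r)) flipʳ
step-bound (jumpʳ {l} {r} {○} {●}) =
  unflip-bound (● ∷ ○ ∷ l , r) (l , ● ∷ ○ ∷ r) (sym (level-○ l r))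
  (flip-≡ (level-○ l r) (flip l r))
step-bound (jumpˡ {l} {r} {●} {●}) =
  level-bound-down (l , ● ∷ ● ∷ r) (● ∷ ● ∷ l , r) refl (m≤n+m _ 2)
step-bound (jumpˡ {l} {r} {○} {○}) =
  level-bound-up (l , ○ ∷ ○ ∷ r) (○ ∷ ○ ∷ l , r) refl jumpˡ
step-bound (jumpˡ {l} {r} {○} {●}) =
  flip-bound (l , ● ∷ ○ ∷ r) (● ∷ ○ ∷ l , r) (level-○ l r) (flip l r) flipˡ
step-bound (jumpˡ {l} {r} {●} {○}) =
  unflip-bound (l , ○ ∷ ● ∷ r) (○ ∷ ● ∷ l , r) (level-○ l r) (flip l r)

-- Dead configurations

-- The configurations from which steps that decrease the potential never lead to
-- the final one: a row has been left unfinished below the vacancy, or unflipped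
-- boxes of the current row lie behind an already flipped one, or on both sides.
data Dead : Zipper → Set where
  skipped  : ∀ {z} → level z < depth (whole z) → Dead z
  blockedˡ : (∀ t → blacks (● ∷ l) ℕ.+ whites t ≤ depth ((● ∷ l) ʳ++ t)) → Dead (● ∷ l , r)
  blockedʳ : (∀ t → blacks t ℕ.+ whites (○ ∷ r) ≤ depth (t ʳ++ ○ ∷ r)) → Dead (l , ○ ∷ r)
  amid     : Dead (○ ∷ ● ∷ l , ● ∷ ○ ∷ r)

depth-flip : ∀ l r → blacks l ℕ.+ suc (whites r) ≤ depth (l ʳ++ ● ∷ ○ ∷ r)
depth-flip l r = ≤-trans (m≤n⊔m (depth (l ʳ++ ○ ∷ ● ∷ r)) _) (≤-reflexive (sym (depth-⊔ (flip l r))))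

depth-flip-> : ∀ {y} → Flip y s s′ → y < depth s → y < depth s′
depth-flip-> {s} {s′} {y} f lt with ⊔-sel (depth s′) y
... | inj₁ eq = <-≤-trans lt (≤-reflexive (trans (depth-⊔ f) eq))
... | inj₂ eq = ⊥-elim (<-irrefl (sym (trans (depth-⊔ f) eq)) lt)

dead-uncleared : ∀ {z} → Dead z → level z ≤ depth (whole z)
dead-uncleared (skipped lt)             = <⇒≤ lt
dead-uncleared (blockedˡ {r = r} below) = below r
dead-uncleared (blockedʳ {l = l} below) = below l
dead-uncleared (amid {l} {r})           = depth-flip (○ ∷ ● ∷ l) r

-- By `dead-uncleared` a box is left in the current row or below, so only flips are tight. They
-- spare a skipped row, and out of `amid` they leave a box behind. The bound in `blockedˡ` is stated
-- for every right side `t` so that it can absorb the two checkers a flip brings over; likewise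
-- `blockedʳ`.
dead-tight : ∀ {z z′} → Dead z → Tight z z′ → Dead z′
dead-tight (skipped lt) (flipʳ {l} {r}) =
  skipped (depth-flip-> (flip l r) (≤-<-trans (≤-reflexive (level-○ l r)) lt))
dead-tight (skipped lt) (flipˡ {l} {r}) =
  skipped (≤-<-trans (≤-reflexive (sym (level-○ l r))) (depth-flip-> (flip l r) lt))
dead-tight (blockedˡ {l} below) flipˡ =
  blockedˡ λ t → ≤-trans (≤-reflexive (sym (level-○ (● ∷ l) t))) (below (○ ∷ ● ∷ t))
dead-tight (blockedʳ {r} below) flipʳ =
  blockedʳ λ t → ≤-trans (≤-reflexive (level-○ t (○ ∷ r))) (below (● ∷ ○ ∷ t))
dead-tight (amid {l} {r}) flipʳ =
  blockedʳ λ t → ≤-trans (≤-reflexive (level-○ t (○ ∷ r))) (depth-flip (● ∷ ○ ∷ t) r)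
dead-tight (amid {l} {r}) flipˡ =
  blockedˡ λ t → ≤-trans (≤-reflexive (sym (level-○ (● ∷ l) t)))
                   (≤-trans (≤-reflexive (sym (level-○ l (○ ∷ t)))) (depth-flip l (○ ∷ ● ∷ t)))
dead-tight dead (slideʳ cleared) = ⊥-elim (<⇒≱ cleared (dead-uncleared dead))
dead-tight dead (slideˡ cleared) = ⊥-elim (<⇒≱ cleared (dead-uncleared dead))
dead-tight dead (jumpʳ cleared)  = ⊥-elim (<⇒≱ cleared (dead-uncleared dead))
dead-tight dead (jumpˡ cleared)  = ⊥-elim (<⇒≱ cleared (dead-uncleared dead))

depth-ʳ++ : ∀ l {r y} → 1 ≤ whites r → y ≤ depth r → blacks l ℕ.+ y ≤ depth (l ʳ++ r)
depth-ʳ++ []      1≤w y≤d = y≤d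
depth-ʳ++ (○ ∷ l) 1≤w y≤d = depth-ʳ++ l (s≤s z≤n) y≤d
depth-ʳ++ (● ∷ l) {r} {y} 1≤w y≤d =
  ≤-trans (≤-reflexive (sym (+-suc (blacks l) y))) (depth-ʳ++ l 1≤w (lemma (whites r) 1≤w))
  where
  lemma : ∀ k → 1 ≤ k → suc y ≤ raise k (depth r)
  lemma (suc k) _ = s≤s (≤-trans y≤d (m≤m⊔n (depth r) k))

-- The black checker beside the vacancy and the first white one to the right form a box one row
-- above the vacancy.
level≤1+depth : ∀ l r → 1 ≤ whites r → blacks (● ∷ l) ℕ.+ whites r ≤ suc (depth ((● ∷ l) ʳ++ r))
level≤1+depth l r 1≤w = s≤s (depth-ʳ++ l 1≤w (raise-≥ (whites r) (depth r)))

-- Steps of optimal solutions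

data Advance : Zipper → Zipper → Set where
  flipʳ  : Advance (○ ∷ ● ∷ l , r) (l , ○ ∷ ● ∷ r)
  flipˡ  : Advance (l , ● ∷ ○ ∷ r) (● ∷ ○ ∷ l , r)
  slideʳ : Advance (● ∷ l , r) (l , ● ∷ r)
  slideˡ : Advance (l , ○ ∷ r) (○ ∷ l , r)

Live : Zipper → Set
Live z = level z ≤ suc (depth (whole z))

advance-step : ∀ {z z′} → Advance z z′ → Step z z′
advance-step flipʳ  = jumpʳ
advance-step flipˡ  = jumpˡ
advance-step slideʳ = slideʳ
advance-step slideˡ = slideˡ

advance-length : ∀ {z z′} → Advance z z′ → liveLength z ≡ suc (liveLength z′)
advance-length (flipʳ {l} {r})  = cong₂ ℕ._+_ (inversion (flip l r)) (sym (level-○ l r))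
advance-length (flipˡ {l} {r})  = cong₂ ℕ._+_ (inversion (flip l r)) (level-○ l r)
advance-length (slideʳ {l} {r}) = +-suc _ _
advance-length (slideˡ {l} {r}) = trans (cong (inversions (l ʳ++ ○ ∷ r) ℕ.+_) (level-○ l r)) (+-suc _ _)

advance-live : ∀ {z z′} → Advance z z′ → Live z → Live z′
advance-live (flipʳ {l} {r})  _    = depth-drop (flip l r)
advance-live (flipˡ {l} {r})  _    = ≤-trans (≤-reflexive (sym (level-○ l r))) (depth-drop (flip l r))
advance-live (slideʳ {l} {r}) live = ≤-trans (n≤1+n _) live
advance-live (slideˡ {l} {r}) live = ≤-trans (+-monoʳ-≤ (blacks l) (n≤1+n _)) live

-- Under `Live` the minimum in `rows` is the level itself.
live-potential : ∀ z → Live z → liveLength z ≤ potential z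
live-potential z live = +-monoʳ-≤ (inversions (whole z)) (≤-trans (⊓-glb ≤-refl live) (m≤n⊔m (depth (whole z)) _))

-- Correspondence of zippers and rows

toRow : Zipper → List Cell
toRow (l , r) = map checker l ʳ++ O ∷ map checker r

-- The right-hand side contains just one vacancy, which fixes the splitting.
++-O-injective : ∀ xs {ys l r} → xs ++ O ∷ ys ≡ map checker l ++ O ∷ map checker r →
                 xs ≡ map checker l × ys ≡ map checker r
++-O-injective []       {l = []}    eq = refl , ∷-injectiveʳ eq
++-O-injective []       {l = _ ∷ _} eq = case ∷-injectiveˡ eq of λ ()
++-O-injective (x ∷ xs) {l = c ∷ l} eq with ++-O-injective xs (∷-injectiveʳ eq)
... | p , q = cong₂ _∷_ (∷-injectiveˡ eq) p , q
++-O-injective (x ∷ xs) {l = []} {r} eq = ⊥-elim (no-O r xs (sym (∷-injectiveʳ eq)))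
  where
  no-O : ∀ r xs {ys} → map checker r ≢ xs ++ O ∷ ys
  no-O (_ ∷ r) []       eq = case ∷-injectiveˡ eq of λ ()
  no-O (_ ∷ r) (_ ∷ xs) eq = no-O r xs (∷-injectiveʳ eq)

ʳ++-O-injective : ∀ xs {ys} l r → xs ʳ++ O ∷ ys ≡ toRow (l , r) →
                  xs ≡ map checker l × ys ≡ map checker r
ʳ++-O-injective xs {ys} l r eq with ++-O-injective (reverse xs) {l = reverse l} eq′
  where
  open ≡-Reasoning
  eq′ : reverse xs ++ O ∷ ys ≡ map checker (reverse l) ++ O ∷ map checker r
  eq′ = begin
    reverse xs ++ O ∷ ys                           ≡⟨ ʳ++-defn xs ⟨
    xs ʳ++ O ∷ ys                                  ≡⟨ eq ⟩
    map checker l ʳ++ O ∷ map checker r            ≡⟨ ʳ++-defn (map checker l) ⟩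
    reverse (map checker l) ++ O ∷ map checker r   ≡⟨ cong (_++ O ∷ map checker r) (reverse-map checker l) ⟨
    map checker (reverse l) ++ O ∷ map checker r   ∎
... | p , q = reverse-injective (trans p (reverse-map checker l)) , q

checker-injective : ∀ {c d} → checker c ≡ checker d → c ≡ d
checker-injective refl = refl

toRow-injective : ∀ {z z′} → toRow z ≡ toRow z′ → z ≡ z′
toRow-injective {l , r} {l′ , r′} eq with ʳ++-O-injective (map checker l) l′ r′ eq
... | p , q = cong₂ _,_ (map-injective checker-injective p) (map-injective checker-injective q)

++-reverse : ∀ {A : Set} (xs ys : List A) → xs ++ ys ≡ reverse xs ʳ++ ys
++-reverse xs ys = sym (trans (ʳ++-defn (reverse xs)) (cong (_++ ys) (reverse-involutive xs)))

step-move : ∀ {z z′} → Step z z′ → Move (toRow z) (toRow z′)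
step-move (slideʳ {l} {r} {c})
  rewrite ʳ++-defn (map checker l) {checker c ∷ O ∷ map checker r}
        | ʳ++-defn (map checker l) {O ∷ checker c ∷ map checker r} = slideʳ _ c _
step-move (slideˡ {l} {r} {c})
  rewrite ʳ++-defn (map checker l) {checker c ∷ O ∷ map checker r}
        | ʳ++-defn (map checker l) {O ∷ checker c ∷ map checker r} = slideˡ _ c _
step-move (jumpʳ {l} {r} {c} {d})
  rewrite ʳ++-defn (map checker l) {checker c ∷ checker d ∷ O ∷ map checker r}
        | ʳ++-defn (map checker l) {O ∷ checker d ∷ checker c ∷ map checker r} = jumpʳ _ c d _
step-move (jumpˡ {l} {r} {c} {d})
  rewrite ʳ++-defn (map checker l) {checker c ∷ checker d ∷ O ∷ map checker r}
        | ʳ++-defn (map checker l) {O ∷ checker d ∷ checker c ∷ map checker r} = jumpˡ _ c d _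

map-checker-∷ : ∀ {c xs} l → checker c ∷ xs ≡ map checker l → ∃[ l′ ] l ≡ c ∷ l′ × xs ≡ map checker l′
map-checker-∷ (_ ∷ l) eq = l , cong (_∷ l) (checker-injective (sym (∷-injectiveˡ eq))) , ∷-injectiveʳ eq

++-toRow : ∀ xs ys {l} → reverse xs ≡ map checker l → xs ++ ys ≡ map checker l ʳ++ ys
++-toRow xs ys eq = trans (++-reverse xs ys) (cong (_ʳ++ ys) eq)

-- The vacancy of the move must be that of the zipper, so the checkers involved can be peeled off
-- its two sides.
move-step : ∀ {xs ys} z → xs ≡ toRow z → Move xs ys → ∃[ z′ ] Step z z′ × ys ≡ toRow z′
move-step (l , r) eq (slideʳ xs c ys)
  with p , refl ← ʳ++-O-injective (checker c ∷ reverse xs) l r (trans (sym (++-reverse xs _)) eq)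
  with l′ , refl , p′ ← map-checker-∷ l p
  = _ , slideʳ , ++-toRow xs _ p′
move-step (l , r) eq (slideˡ xs c ys)
  with p , q ← ʳ++-O-injective (reverse xs) l r (trans (sym (++-reverse xs _)) eq)
  with r′ , refl , refl ← map-checker-∷ r q
  = _ , slideˡ , ++-toRow xs _ p
move-step (l , r) eq (jumpʳ xs c d ys)
  with p , refl ← ʳ++-O-injective (checker d ∷ checker c ∷ reverse xs) l r (trans (sym (++-reverse xs _)) eq)
  with l′ , refl , p′ ← map-checker-∷ l p
  with l″ , refl , p″ ← map-checker-∷ l′ p′
  = _ , jumpʳ , ++-toRow xs _ p″
move-step (l , r) eq (jumpˡ xs c d ys)
  with p , q ← ʳ++-O-injective (reverse xs) l r (trans (sym (++-reverse xs _)) eq)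
  with r′ , refl , q′ ← map-checker-∷ r q
  with r″ , refl , refl ← map-checker-∷ r′ q′
  = _ , jumpˡ , ++-toRow xs _ p

count-++ : ∀ c xs ys → count c (xs ++ ys) ≡ count c xs ℕ.+ count c ys
count-++ c xs ys = trans (cong length (filter-++ (c ≟_) xs ys)) (length-++ (filter (c ≟_) xs))

count-swap : ∀ e x y zs → count e (x ∷ y ∷ zs) ≡ count e (y ∷ x ∷ zs)
count-swap e x y zs = begin
  count e (x ∷ y ∷ zs)               ≡⟨ split x y ⟩
  [ x ]# ℕ.+ ([ y ]# ℕ.+ count e zs) ≡⟨ x∙yz≈y∙xz +-commutativeSemigroup [ x ]# [ y ]# (count e zs) ⟩
  [ y ]# ℕ.+ ([ x ]# ℕ.+ count e zs) ≡⟨ split y x ⟨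
  count e (y ∷ x ∷ zs)               ∎
  where
  open ≡-Reasoning
  [_]# : Cell → ℕ
  [ x ]# = count e (x ∷ [])
  split : ∀ x y → count e (x ∷ y ∷ zs) ≡ [ x ]# ℕ.+ ([ y ]# ℕ.+ count e zs)
  split x y = trans (count-++ e (x ∷ []) (y ∷ zs)) (cong ([ x ]# ℕ.+_) (count-++ e (y ∷ []) zs))

count-++-congʳ : ∀ e xs {ys zs} → count e ys ≡ count e zs → count e (xs ++ ys) ≡ count e (xs ++ zs)
count-++-congʳ e xs {ys} {zs} eq =
  trans (count-++ e xs ys) (trans (cong (count e xs ℕ.+_) eq) (sym (count-++ e xs zs)))

count-jump : ∀ e x y z zs → count e (x ∷ y ∷ z ∷ zs) ≡ count e (z ∷ y ∷ x ∷ zs)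
count-jump e x y z zs = begin
  count e (x ∷ y ∷ z ∷ zs) ≡⟨ count-swap e x y (z ∷ zs) ⟩
  count e (y ∷ x ∷ z ∷ zs) ≡⟨ count-++-congʳ e (y ∷ []) (count-swap e x z zs) ⟩
  count e (y ∷ z ∷ x ∷ zs) ≡⟨ count-swap e y z (x ∷ zs) ⟩
  count e (z ∷ y ∷ x ∷ zs) ∎
  where open ≡-Reasoning

-- This turns the row reached by a step into a configuration in `step-edge`.
count-move : ∀ e {xs ys} → Move xs ys → count e ys ≡ count e xs
count-move e (slideʳ xs c ys)  = count-++-congʳ e xs (count-swap e O (checker c) ys)
count-move e (slideˡ xs c ys)  = count-++-congʳ e xs (count-swap e (checker c) O ys)
count-move e (jumpʳ xs c d ys) = count-++-congʳ e xs (count-jump e O (checker d) (checker c) ys)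
count-move e (jumpˡ xs c d ys) = count-++-congʳ e xs (count-jump e (checker c) (checker d) O ys)

configuration-≡ : ∀ {n m} {x y : Configuration n m} → row x ≡ row y → x ≡ y
configuration-≡ refl = refl

record _at_ {n m : ℕ} (x : Configuration n m) (z : Zipper) : Set where
  constructor same-row
  field row≡ : row x ≡ toRow z

at-unique : ∀ {n m z} {x y : Configuration n m} → x at z → y at z → x ≡ y
at-unique (same-row p) (same-row q) = configuration-≡ (trans p (sym q))

at-injective : ∀ {n m z z′} {x : Configuration n m} → x at z → x at z′ → z ≡ z′
at-injective (same-row p) (same-row q) = toRow-injective (trans (sym p) q)

edge-step : ∀ {n m z} {x x′ : Configuration n m} → x at z → Edge x x′ → ∃[ z′ ] Step z z′ × x′ at z′
edge-step {z = z} (same-row p) e with z′ , st , q ← move-step z p e = z′ , st , same-row q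

step-edge : ∀ {n m z z′} {x : Configuration n m} → x at z → Step z z′ → ∃[ x′ ] x′ at z′ × Edge x x′
step-edge {z = z} {z′} {configuration ρ bs ws os} (same-row p) st =
  configuration (toRow z′) (trans (count-move b mv) bs) (trans (count-move w mv) ws) (trans (count-move O mv) os)
  , same-row refl , mv
  where
  mv : Move ρ (toRow z′)
  mv = subst (λ σ → Move σ (toRow z′)) (sym p) (step-move st)

-- Cardinalities

module _ {A : Set} where

  card-singleton : ∀ {P : A → Set} x → P x → (∀ y → P y → y ≡ x) → HasCardinality P 1
  card-singleton {P} x px unique =
    x ∷ [] , [] ∷ [] , (λ y → mk⇔ (λ { (here refl) → px }) (λ py → here (unique y py))) , refl

  card-∅ : ∀ {P : A → Set} → (∀ x → ¬ P x) → HasCardinality P 0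
  card-∅ none = [] , [] , (λ x → mk⇔ (λ ()) (λ px → ⊥-elim (none x px))) , refl

  card-⇔ : ∀ {P Q : A → Set} {k} → (∀ x → P x ⇔ Q x) → HasCardinality P k → HasCardinality Q k
  card-⇔ P⇔Q (xs , uniq , mem , len) =
    xs , uniq , (λ x → mk⇔ (to (P⇔Q x) ∘ to (mem x)) (from (mem x) ∘ from (P⇔Q x))) , len
    where open Equivalence

  card-⊎ : ∀ {P Q : A → Set} {j k} → (∀ x → P x → ¬ Q x) →
           HasCardinality P j → HasCardinality Q k → HasCardinality (λ x → P x ⊎ Q x) (j ℕ.+ k)
  card-⊎ disjoint (xs , uniq , mem , len) (ys , uniq′ , mem′ , len′) =
    xs ++ ys
    , Unique.++⁺ uniq uniq′ (λ (∈xs , ∈ys) → disjoint _ (to (mem _) ∈xs) (to (mem′ _) ∈ys))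
    , (λ x → mk⇔ ([ inj₁ ∘ to (mem x) , inj₂ ∘ to (mem′ x) ]′ ∘ ∈-++⁻ xs)
                 [ ∈-++⁺ˡ ∘ from (mem x) , ∈-++⁺ʳ xs ∘ from (mem′ x) ]′)
    , trans (length-++ xs) (cong₂ ℕ._+_ len len′)
    where open Equivalence

  card-∷ : ∀ {P : List A → Set} {k} y → HasCardinality P k →
           HasCardinality (λ xs → ∃[ ys ] P ys × xs ≡ y ∷ ys) k
  card-∷ y (xss , uniq , mem , len) =
    map (y ∷_) xss
    , Unique.map⁺ ∷-injectiveʳ uniq
    , (λ xs → mk⇔ (λ xs∈ → let ys , ys∈ , eq = ∈-map⁻ (y ∷_) xs∈ in ys , to (mem ys) ys∈ , eq)
                  (λ { (ys , p , refl) → ∈-map⁺ (y ∷_) (from (mem ys) p) }))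
    , trans (length-map (y ∷_) xss) len
    where open Equivalence

-- The two end configurations

start goal : ℕ → ℕ → Zipper
start n m = replicate n ● , replicate m ○
goal  n m = replicate m ○ , replicate n ●

replicate-∷ : ∀ {A : Set} k (x : A) ys → replicate k x ++ x ∷ ys ≡ x ∷ replicate k x ++ ys
replicate-∷ zero    x ys = refl
replicate-∷ (suc k) x ys = cong (x ∷_) (replicate-∷ k x ys)

replicate-ʳ++ : ∀ {A : Set} k (x : A) ys → replicate k x ʳ++ ys ≡ replicate k x ++ ys
replicate-ʳ++ zero    x ys = refl
replicate-ʳ++ (suc k) x ys = trans (replicate-ʳ++ k x (x ∷ ys)) (replicate-∷ k x ys)

toRow-replicate : ∀ i c j d →
  toRow (replicate i c , replicate j d) ≡ replicate i (checker c) ++ O ∷ replicate j (checker d)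
toRow-replicate i c j d =
  trans (cong₂ (λ xs ys → xs ʳ++ O ∷ ys) (map-replicate checker i c) (map-replicate checker j d))
        (replicate-ʳ++ i (checker c) _)

blacks-○ : ∀ k → blacks (replicate k ○) ≡ 0
blacks-○ zero    = refl
blacks-○ (suc k) = blacks-○ k

whites-● : ∀ k → whites (replicate k ●) ≡ 0
whites-● zero    = refl
whites-● (suc k) = whites-● k

inversions-○-ʳ++ : ∀ k s → inversions (replicate k ○ ʳ++ s) ≡ inversions s
inversions-○-ʳ++ zero    s = refl
inversions-○-ʳ++ (suc k) s = inversions-○-ʳ++ k (○ ∷ s)

depth-○-ʳ++ : ∀ k s → depth (replicate k ○ ʳ++ s) ≡ depth s
depth-○-ʳ++ zero    s = refl
depth-○-ʳ++ (suc k) s = depth-○-ʳ++ k (○ ∷ s)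

inversions-● : ∀ k → inversions (replicate k ●) ≡ 0
inversions-● zero    = refl
inversions-● (suc k) = cong₂ ℕ._+_ (whites-● k) (inversions-● k)

level-goal : ∀ n m → level (goal n m) ≡ 0
level-goal n m = cong₂ ℕ._+_ (blacks-○ m) (whites-● n)

inversions-goal : ∀ n m → inversions (whole (goal n m)) ≡ 0
inversions-goal n m = trans (inversions-○-ʳ++ m (replicate n ●)) (inversions-● n)

depth-goal : ∀ n m → depth (whole (goal n m)) ≡ 0
depth-goal n m = trans (depth-○-ʳ++ m (replicate n ●)) (depth-no-whites (replicate n ●) (whites-● n))

potential-goal : ∀ n m → potential (goal n m) ≡ 0
potential-goal n m = cong₂ ℕ._+_ (inversions-goal n m) (cong₂ rows (depth-goal n m) (level-goal n m))

goal-alive : ∀ n m → ¬ Dead (goal n m)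
goal-alive n m dead = go dead refl
  where
  -- For variable `n` and `m` the goal is not in constructor form, hence the detour through an
  -- equation.
  go : ∀ {z} → Dead z → z ≢ goal n m
  go (skipped {z} lt) refl = n≮0 (<-≤-trans lt (≤-reflexive (depth-goal n m)))
  go (blockedˡ _) eq = ●≢○ m (cong proj₁ eq)
    where
    ●≢○ : ∀ m {l} → ● ∷ l ≢ replicate m ○
    ●≢○ (suc m) ()
  go (blockedʳ _) eq = ○≢● n (cong proj₂ eq)
    where
    ○≢● : ∀ n {r} → ○ ∷ r ≢ replicate n ●
    ○≢● (suc n) ()
  go amid eq = clash m (cong proj₁ eq)
    where
    clash : ∀ m {l} → ○ ∷ ● ∷ l ≢ replicate m ○
    clash (suc (suc m)) ()

-- Walks to the final configuration

module _ {n m : ℕ} where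

  data Walk : Configuration n m → ℕ → List (Configuration n m) → Set where
    stop : ∀ {x} → x ≡ final n m → Walk x 0 (x ∷ [])
    go   : ∀ {x x′ k vs} → Edge x x′ → Walk x′ k vs → Walk x (suc k) (x ∷ vs)

  path⇒walk : ∀ {x} vs → IsPath Edge x (final n m) vs → Walk x (edges vs) vs
  path⇒walk [] record { starts = () }
  path⇒walk (x ∷ []) record { starts = refl ; ends = end } = stop (just-injective end)
  path⇒walk (x ∷ x′ ∷ vs) record { starts = refl ; ends = end ; steps = e ∷ es } =
    go e (path⇒walk (x′ ∷ vs) record { starts = refl ; ends = end ; steps = es })

  walk⇒path : ∀ {x k vs} → Walk x k vs → IsPath Edge x (final n m) vs
  walk⇒path (stop refl) = record { starts = refl ; ends = refl ; steps = [-] }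
  walk⇒path (go e wk) with walk⇒path wk
  walk⇒path (go e (stop _)) | record { ends = end ; steps = es } = record { starts = refl ; ends = end ; steps = e ∷ es }
  walk⇒path (go e (go _ _)) | record { ends = end ; steps = es } = record { starts = refl ; ends = end ; steps = e ∷ es }

  walk-edges : ∀ {x k vs} → Walk x k vs → edges vs ≡ k
  walk-edges (stop _)          = refl
  walk-edges (go e (stop _))   = refl
  walk-edges (go e wk@(go _ _)) = cong suc (walk-edges wk)

  final-at : final n m at goal n m
  final-at = same-row (sym (toRow-replicate m ○ n ●))

  walk-potential : ∀ {x k vs z} → Walk x k vs → x at z → potential z ≤ k
  walk-potential (stop refl) p rewrite at-injective p final-at = ≤-reflexive (potential-goal n m)
  walk-potential (go {x′ = x′} e wk) p with z′ , st , p′ ← edge-step {x′ = x′} p e =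
    ≤-trans (proj₁ (step-bound st)) (s≤s (walk-potential wk p′))

  -- A walk no longer than the potential has no slack: its remainder is at least as long as the next
  -- potential, so the first step must lower the potential, and the remainder has no slack either.
  walk-tight : ∀ {x x′ k vs z} → Edge x x′ → Walk x′ k vs → x at z → suc k ≤ potential z →
               ∃[ z′ ] Tight z z′ × x′ at z′ × k ≤ potential z′
  walk-tight {x′ = x′} e wk p le with z′ , st , p′ ← edge-step {x′ = x′} p e =
    z′ , proj₂ (step-bound st) (≤-trans (s≤s (walk-potential wk p′)) le) , p′
       , ℕ.s≤s⁻¹ (≤-trans le (proj₁ (step-bound st)))

  dead-walk : ∀ {x k vs z} → Dead z → Walk x k vs → x at z → ¬ k ≤ potential z
  dead-walk dead (stop refl) p _ rewrite at-injective p final-at = goal-alive n m dead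
  dead-walk dead (go e wk) p le with _ , tight , p′ , le′ ← walk-tight e wk p le =
    dead-walk (dead-tight dead tight) wk p′ le′

-- Counting walks by their first step

-- For live configurations the potential is at least liveLength; so this counts the
-- walks to the final configuration that decrease the potential at every step.
Count : ℕ → ℕ → Zipper → ℕ → Set
Count n m z k = ∀ {x : Configuration n m} → x at z → Live z → HasCardinality (Walk x (liveLength z)) k

module _ {n m : ℕ} where

  count-goal : Count n m (goal n m) 1
  count-goal {x} p _ rewrite cong₂ ℕ._+_ (inversions-goal n m) (level-goal n m) =
    card-singleton (x ∷ []) (stop (at-unique p final-at)) λ { _ (stop _) → refl }

  count-dead : ∀ {z} → Dead z → Count n m z 0
  count-dead {z} dead p live = card-∅ λ _ wk → dead-walk dead wk p (live-potential z live)

  FirstStep : ∀ (x x′ : Configuration n m) → ℕ → List (Configuration n m) → Set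
  FirstStep x x′ k vs = ∃[ vs′ ] Walk x′ k vs′ × vs ≡ x ∷ vs′

  firstStep-walk : ∀ {x x′ k vs} → Edge x x′ → FirstStep x x′ k vs → Walk x (suc k) vs
  firstStep-walk e (_ , wk , refl) = go e wk

  -- The second vertex can be read off from the list, so different first steps give disjoint sets of
  -- walks.
  firstStep-unique : ∀ {x x′ x″ j k vs} → FirstStep x x′ j vs → FirstStep x x″ k vs → x′ ≡ x″
  firstStep-unique (_ , wk , refl) (_ , wk′ , refl) = heads wk wk′
    where
    heads : ∀ {x′ x″ j k vs} → Walk x′ j vs → Walk x″ k vs → x′ ≡ x″
    heads (stop _) (stop _) = refl
    heads (stop _) (go _ _) = refl
    heads (go _ _) (stop _) = refl
    heads (go _ _) (go _ _) = refl

  walk-first : ∀ {x z k vs} → x at z → Live z → liveLength z ≡ suc k → Walk x (suc k) vs →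
               ∃[ z′ ] Tight z z′ × ¬ Dead z′ × (∀ {x′} → x′ at z′ → FirstStep x x′ k vs)
  walk-first {x} {z} {k} {vs} p live len (go e wk)
    with z′ , tight , p′ , le ← walk-tight e wk p (≤-trans (≤-reflexive (sym len)) (live-potential z live)) =
    z′ , tight , (λ dead → dead-walk dead wk p′ le)
       , λ p″ → subst (λ x′ → FirstStep x x′ k vs) (at-unique p′ p″) (_ , wk , refl)

  -- Dead successors start no walk that short, so prepending `x` to the walks from `z′` yields all
  -- of them.
  count-forced : ∀ {z z′ k} → Advance z z′ → (∀ {z″} → Tight z z″ → z″ ≡ z′ ⊎ Dead z″) →
                 Count n m z′ k → Count n m z k
  count-forced {z} {z′} {k} adv only count {x} p live
    with x′ , p′ , e ← step-edge p (advance-step adv) =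
    subst (λ i → HasCardinality (Walk x i) k) (sym len)
      (card-⇔ (λ vs → mk⇔ (firstStep-walk e) (back p′)) (card-∷ x (count p′ (advance-live adv live))))
    where
    len = advance-length adv
    back : ∀ {x′ vs} → x′ at z′ → Walk x (suc (liveLength z′)) vs → FirstStep x x′ (liveLength z′) vs
    back p′ wk with z″ , tight , alive , first ← walk-first p live len wk with only tight
    ... | inj₁ refl = first p′
    ... | inj₂ dead = ⊥-elim (alive dead)

  count-fork : ∀ {z z₁ z₂ j k} → z₁ ≢ z₂ → Advance z z₁ → Advance z z₂ →
               (∀ {z″} → Tight z z″ → z″ ≡ z₁ ⊎ z″ ≡ z₂ ⊎ Dead z″) →
               Count n m z₁ j → Count n m z₂ k → Count n m z (j ℕ.+ k)
  count-fork {z} {z₁} {z₂} {j} {k} z₁≢z₂ adv₁ adv₂ only count₁ count₂ {x} p live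
    with x₁ , p₁ , e₁ ← step-edge p (advance-step adv₁)
       | x₂ , p₂ , e₂ ← step-edge p (advance-step adv₂) =
    subst (λ i → HasCardinality (Walk x i) (j ℕ.+ k)) (sym len)
      (card-⇔ (λ vs → mk⇔ [ firstStep-walk e₁ , firstStep-walk e₂ ]′ (back p₁ p₂))
        (card-⊎ (λ _ f₁ f₂ → z₁≢z₂ (at-injective p₁ (subst (_at z₂) (sym (firstStep-unique f₁ f₂)) p₂)))
          (card-∷ x (count₁ p₁ (advance-live adv₁ live)))
          (card-∷ x (subst (λ i → HasCardinality (Walk x₂ i) k) (sym len₁₂) (count₂ p₂ (advance-live adv₂ live))))))
    where
    len = advance-length adv₁
    -- Both successors are one step nearer, so the two counts concern walks of equal length and can
    -- be added.
    len₁₂ : liveLength z₁ ≡ liveLength z₂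
    len₁₂ = suc-injective (trans (sym len) (advance-length adv₂))
    back : ∀ {x₁ x₂ vs} → x₁ at z₁ → x₂ at z₂ → Walk x (suc (liveLength z₁)) vs →
           FirstStep x x₁ (liveLength z₁) vs ⊎ FirstStep x x₂ (liveLength z₁) vs
    back p₁ p₂ wk with z″ , tight , alive , first ← walk-first p live len wk with only tight
    ... | inj₁ refl        = inj₁ (first p₁)
    ... | inj₂ (inj₁ refl) = inj₂ (first p₂)
    ... | inj₂ (inj₂ dead) = ⊥-elim (alive dead)

-- Zigzags and forced moves

NoFlipʳ NoFlipˡ : List Colour → Set
NoFlipʳ l = ∀ {t} → l ≢ ○ ∷ ● ∷ t
NoFlipˡ r = ∀ {t} → r ≢ ● ∷ ○ ∷ t

noFlipʳ : ∀ k c → NoFlipʳ (replicate k c)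
noFlipʳ (suc zero)    ● ()
noFlipʳ (suc zero)    ○ ()
noFlipʳ (suc (suc k)) ● ()
noFlipʳ (suc (suc k)) ○ ()

noFlipˡ : ∀ k c → NoFlipˡ (replicate k c)
noFlipˡ (suc zero)    ● ()
noFlipˡ (suc zero)    ○ ()
noFlipˡ (suc (suc k)) ● ()
noFlipˡ (suc (suc k)) ○ ()

zig zag : ℕ → List Colour → List Colour
zig zero    s = s
zig (suc k) s = ● ∷ ○ ∷ zig k s
zag zero    s = s
zag (suc k) s = ○ ∷ ● ∷ zag k s

zig-comm : ∀ k s → zig k (● ∷ ○ ∷ s) ≡ zig (suc k) s
zig-comm zero    s = refl
zig-comm (suc k) s = cong (λ t → ● ∷ ○ ∷ t) (zig-comm k s)

zag-comm : ∀ k s → zag k (○ ∷ ● ∷ s) ≡ zag (suc k) s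
zag-comm zero    s = refl
zag-comm (suc k) s = cong (λ t → ○ ∷ ● ∷ t) (zag-comm k s)

-- Grouped in the other way, the flipped corners of one zigzag are the boxes of the next.
zig-● : ∀ k s → zig k (● ∷ s) ≡ ● ∷ zag k s
zig-● zero    s = refl
zig-● (suc k) s = cong (λ t → ● ∷ ○ ∷ t) (zig-● k s)

zag-○ : ∀ k s → zag k (○ ∷ s) ≡ ○ ∷ zig k s
zag-○ zero    s = refl
zag-○ (suc k) s = cong (λ t → ○ ∷ ● ∷ t) (zag-○ k s)

module _ {n m : ℕ} where

  -- Neither side allows a flip here, and a jump over a like checker would pass over the row just
  -- above, where a box remains.
  fork : ∀ {l r j k} → Count n m (l , ● ∷ ○ ∷ r) j → Count n m (○ ∷ ● ∷ l , r) k →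
         Count n m (● ∷ l , ○ ∷ r) (j ℕ.+ k)
  fork {l} {r} = count-fork (λ eq → m≢1+n+m (length r) (cong (length ∘ proj₂) (sym eq))) slideʳ slideˡ only
    where
    only : ∀ {z} → Tight (● ∷ l , ○ ∷ r) z → z ≡ (l , ● ∷ ○ ∷ r) ⊎ z ≡ (○ ∷ ● ∷ l , r) ⊎ Dead z
    only (slideʳ _) = inj₁ refl
    only (slideˡ _) = inj₂ (inj₁ refl)
    only (jumpʳ {l′} _) = inj₂ (inj₂ (skipped (ℕ.s≤s⁻¹ (level≤1+depth (● ∷ l′) (○ ∷ r) (s≤s z≤n)))))
    only (jumpˡ {r = r′} _) = inj₂ (inj₂ (skipped
      (≤-trans (≤-reflexive (cong suc (sym (level-○ l r′))))
        (≤-trans (≤-reflexive (sym (level-○ l (○ ∷ r′)))) (ℕ.s≤s⁻¹ (level≤1+depth l (○ ∷ ○ ∷ r′) (s≤s z≤n)))))))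

  -- Every tight move from the right takes a white checker there, and a left part beginning with
  -- `● ∷ ○` admits just the slide.
  slideʳ-forced : ∀ {l r k} → whites r ≡ 0 → Count n m (○ ∷ l , ● ∷ r) k → Count n m (● ∷ ○ ∷ l , r) k
  slideʳ-forced {l} {r} none = count-forced slideʳ (only none)
    where
    only : ∀ {r z} → whites r ≡ 0 → Tight (● ∷ ○ ∷ l , r) z → z ≡ (○ ∷ l , ● ∷ r) ⊎ Dead z
    only _ (slideʳ _) = inj₁ refl

  slideˡ-forced : ∀ {l r k} → blacks l ≡ 0 → Count n m (○ ∷ l , ● ∷ r) k → Count n m (l , ○ ∷ ● ∷ r) k
  slideˡ-forced {l} {r} none = count-forced slideˡ (only none)
    where
    only : ∀ {l z} → blacks l ≡ 0 → Tight (l , ○ ∷ ● ∷ r) z → z ≡ (○ ∷ l , ● ∷ r) ⊎ Dead z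
    only _ (slideˡ _) = inj₁ refl

  -- The box beside the vacancy lies in the current row, so no upward move is tight yet.
  flipˡ-forced : ∀ {l r k} → NoFlipʳ l → Count n m (● ∷ ○ ∷ l , r) k → Count n m (l , ● ∷ ○ ∷ r) k
  flipˡ-forced {l} {r} noFlip = count-forced flipˡ (only noFlip)
    where
    only : ∀ {l z} → NoFlipʳ l → Tight (l , ● ∷ ○ ∷ r) z → z ≡ (● ∷ ○ ∷ l , r) ⊎ Dead z
    only noFlip flipʳ                = ⊥-elim (noFlip refl)
    only noFlip flipˡ                = inj₁ refl
    only {l} noFlip (slideʳ cleared) = ⊥-elim (<⇒≱ cleared (depth-flip l r))
    only {l} noFlip (jumpʳ cleared)  = ⊥-elim (<⇒≱ cleared (depth-flip l r))

  flipʳ-forced : ∀ {l r k} → NoFlipˡ r → Count n m (l , ○ ∷ ● ∷ r) k → Count n m (○ ∷ ● ∷ l , r) k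
  flipʳ-forced {l} {r} noFlip = count-forced flipʳ (only noFlip)
    where
    uncleared : ∀ r → level (○ ∷ ● ∷ l , r) ≤ depth (whole (○ ∷ ● ∷ l , r))
    uncleared r = ≤-trans (≤-reflexive (sym (level-○ l r))) (depth-flip l r)
    only : ∀ {r z} → NoFlipˡ r → Tight (○ ∷ ● ∷ l , r) z → z ≡ (l , ○ ∷ ● ∷ r) ⊎ Dead z
    only noFlip flipˡ                = ⊥-elim (noFlip refl)
    only noFlip flipʳ                = inj₁ refl
    only {r} noFlip (slideˡ cleared) = ⊥-elim (<⇒≱ cleared (uncleared r))
    only {r} noFlip (jumpˡ cleared)  = ⊥-elim (<⇒≱ cleared (uncleared r))

  -- Each flip puts a black checker directly left of the vacancy, which rules out flipping back the
  -- other way; the assumption on `l` takes care of the first flip.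
  sweepʳ : ∀ i {l r k} → NoFlipʳ l → Count n m (zig i l , r) k → Count n m (l , zig i r) k
  sweepʳ zero    noFlip count = count
  sweepʳ (suc i) {l} {r} {k} noFlip count = flipˡ-forced noFlip
    (sweepʳ i (λ ()) (subst (λ t → Count n m (t , r) k) (sym (zig-comm i l)) count))

  sweepˡ : ∀ i {l r k} → NoFlipˡ r → Count n m (l , zag i r) k → Count n m (zag i l , r) k
  sweepˡ zero    noFlip count = count
  sweepˡ (suc i) {l} {r} {k} noFlip count = flipʳ-forced noFlip
    (sweepˡ i (λ ()) (subst (λ t → Count n m (l , t) k) (sym (zag-comm i r)) count))

  -- Both ends of the zigzag have reached the ends of the row, so the rows of boxes
  -- get shorter; one with i boxes has just been swept (rightwards in the case ʳ).
  mutual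
    shrinkʳ : ∀ i a c → i ℕ.+ a ≡ m → i ℕ.+ c ≡ n → Count n m (zig i (replicate a ○) , replicate c ●) 1
    shrinkʳ zero    a c refl refl = count-goal
    shrinkʳ (suc i) a c p q = slideʳ-forced (whites-● c)
      (subst (λ t → Count n m (t , replicate (suc c) ●) 1) (zag-○ i (replicate a ○))
        (sweepˡ i (noFlipˡ (suc c) ●) (shrinkˡ i (suc a) (suc c) (trans (+-suc i a) p) (trans (+-suc i c) q))))

    shrinkˡ : ∀ i a c → i ℕ.+ a ≡ m → i ℕ.+ c ≡ n → Count n m (replicate a ○ , zag i (replicate c ●)) 1
    shrinkˡ zero    a c refl refl = count-goal
    shrinkˡ (suc i) a c p q = slideˡ-forced (blacks-○ a)
      (subst (λ t → Count n m (replicate (suc a) ○ , t) 1) (zig-● i (replicate c ●))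
        (sweepʳ i (noFlipʳ (suc a) ○) (shrinkʳ i (suc a) (suc c) (trans (+-suc i a) p) (trans (+-suc i c) q))))

-- One white checker

module _ {n : ℕ} where

  mutual
    -- Here `a` boxes are left. In `fibʳ` only black checkers are on the right, so the slide is
    -- forced; in `fibˡ`, while `a` is positive, the vacancy is between a black and a white checker
    -- and both slides are open. This is the Fibonacci recursion.
    fibʳ : ∀ a c → a ℕ.+ suc c ≡ n → Count n 1 (zig 1 (replicate a ●) , replicate c ●) (F (suc a))
    fibʳ zero    c p = shrinkʳ 1 0 c refl p
    fibʳ (suc a) c p = slideʳ-forced (whites-● c)
      (flipʳ-forced (noFlipˡ (suc c) ●) (fibˡ a (suc c) (trans (+-suc a (suc c)) p)))

    fibˡ : ∀ a c → a ℕ.+ suc c ≡ n → Count n 1 (replicate a ● , zag 1 (replicate c ●)) (F (suc (suc a)))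
    fibˡ zero    c p = shrinkˡ 1 0 c refl p
    fibˡ (suc a) c p = subst (Count n 1 _) (+-comm (F (suc a)) (F (suc (suc a))))
      (fork (flipˡ-forced (noFlipʳ a ●) (fibʳ a (suc c) p′)) (flipʳ-forced (noFlipˡ (suc c) ●) (fibˡ a (suc c) p′)))
      where
      p′ : a ℕ.+ suc (suc c) ≡ n
      p′ = trans (+-suc a (suc c)) p

count-one : ∀ a → Count (suc a) 1 (start (suc a) 1) (F (suc a ℕ.+ 2))
count-one a = subst (Count (suc a) 1 _) (trans (+-comm (F (suc a)) _) (cong F (+-comm 2 (suc a))))
  (fork (flipˡ-forced (noFlipʳ a ●) (fibʳ a 0 (+-comm a 1))) (flipʳ-forced (λ ()) (fibˡ a 0 (+-comm a 1))))

-- At least two white checkers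

module _ {n p : ℕ} where

  private
    m : ℕ
    m = suc (suc p)

  -- Only the left end of the zigzag still advances, so all rows have m boxes.
  mutual
    shiftʳ : ∀ a c → a ℕ.+ (m ℕ.+ c) ≡ n → Count n m (zig m (replicate a ●) , replicate c ●) 1
    shiftʳ zero    c q = shrinkʳ m 0 c (+-identityʳ m) q
    shiftʳ (suc a) c q = slideʳ-forced (whites-● c)
      (subst (λ t → Count n m (○ ∷ t , replicate (suc c) ●) 1) (sym (zig-● (suc p) (replicate a ●)))
        (sweepˡ m (noFlipˡ (suc c) ●) (shiftˡ a (suc c) (trans (cong (a ℕ.+_) (+-suc m c)) (trans (+-suc a (m ℕ.+ c)) q)))))

    shiftˡ : ∀ a c → a ℕ.+ (m ℕ.+ c) ≡ n → Count n m (replicate a ● , zag m (replicate c ●)) 1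
    shiftˡ zero    c q = shrinkˡ m 0 c (+-identityʳ m) q
    shiftˡ (suc a) c q = fork
      (subst (λ t → Count n m (replicate a ● , t) 1) (zig-● m (replicate c ●))
        (sweepʳ m (noFlipʳ a ●) (shiftʳ a (suc c) (trans (cong (a ℕ.+_) (+-suc m c)) (trans (+-suc a (m ℕ.+ c)) q)))))
      (count-dead amid)

module _ {e p : ℕ} where

  private
    m n : ℕ
    m = suc (suc p)
    n = m ℕ.+ e

  -- Both ends of the zigzag advance, so the rows get longer.
  mutual
    growʳ : ∀ i c → suc (i ℕ.+ c) ≡ m → Count n m (zig (suc i) (replicate (c ℕ.+ e) ●) , replicate c ○) 1
    -- The zigzag now has all `m` boxes and touches the right end of the row; `e` more rows of this
    -- length follow.
    growʳ i zero q rewrite trans (sym (+-identityʳ i)) (suc-injective q) = shiftʳ e 0 (trans (cong (e ℕ.+_) (+-identityʳ m)) (+-comm e m))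
    growʳ i (suc c) q = fork
      -- Sliding the black checker lands the vacancy inside the next zigzag instead of on its end.
      (subst (λ t → Count n m (○ ∷ t , ● ∷ replicate (suc c) ○) 0) (sym (zig-● i (replicate (c ℕ.+ e) ●))) (count-dead amid))
      (subst (λ t → Count n m (○ ∷ ● ∷ ○ ∷ t , replicate c ○) 1) (sym (zig-● i (replicate (c ℕ.+ e) ●)))
        (sweepˡ (suc (suc i)) (noFlipˡ c ○) (growˡ (suc i) c (trans (cong suc (sym (+-suc i c))) q))))

    growˡ : ∀ i c → suc (i ℕ.+ c) ≡ m → Count n m (replicate (c ℕ.+ e) ● , zag (suc i) (replicate c ○)) 1
    growˡ i zero q rewrite trans (sym (+-identityʳ i)) (suc-injective q) = shiftˡ e 0 (trans (cong (e ℕ.+_) (+-identityʳ m)) (+-comm e m))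
    growˡ i (suc c) q = fork
      (subst (λ t → Count n m (replicate (c ℕ.+ e) ● , ● ∷ ○ ∷ ● ∷ t) 1) (sym (zag-○ i (replicate c ○)))
        (sweepʳ (suc (suc i)) (noFlipʳ (c ℕ.+ e) ●) (growʳ (suc i) c (trans (cong suc (sym (+-suc i c))) q))))
      (subst (λ t → Count n m (○ ∷ ● ∷ replicate (c ℕ.+ e) ● , ● ∷ t) 0) (sym (zag-○ i (replicate c ○))) (count-dead amid))

  -- One solution for each choice of the first slide.
  count-two : Count n m (start n m) 2
  count-two = fork (flipˡ-forced (noFlipʳ (suc p ℕ.+ e) ●) (growʳ 0 (suc p) refl))
                   (flipʳ-forced (noFlipˡ (suc p) ○) (growˡ 0 (suc p) refl))

-- From walks to optimal solutions

nonempty : {A : Set} {P : A → Set} {k : ℕ} → 0 < k → HasCardinality P k → ∃[ x ] P x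
nonempty _  (x ∷ _ , _ , mem , _) = x , Equivalence.to (mem x) (here refl)
nonempty () ([] , _ , _ , refl)

start-live : ∀ n m → Live (start (suc n) (suc m))
start-live n m = level≤1+depth (replicate n ●) (replicate (suc m) ○) (s≤s z≤n)

-- As `k` is positive, some walk attains the lower bound `L` that the potential puts on all paths;
-- hence the shortest paths are exactly the walks with `L` edges.
optimal-cardinality : ∀ {n m k} → Live (start n m) → 0 < k → Count n m (start n m) k →
                      HasCardinality (IsOptimalSolution n m) k
optimal-cardinality {n} {m} live 0<k count = card-⇔ (λ vs → mk⇔ walk⇒optimal (optimal⇒walk vs)) card
  where
  initial-at : initial n m at start n m
  initial-at = same-row (sym (toRow-replicate n ● m ○))

  L : ℕ
  L = liveLength (start n m)

  card = count initial-at live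

  L≤edges : ∀ vs → IsPath Edge (initial n m) (final n m) vs → L ≤ edges vs
  L≤edges vs path = ≤-trans (live-potential (start n m) live) (walk-potential (path⇒walk vs path) initial-at)

  walk⇒optimal : ∀ {vs} → Walk (initial n m) L vs → IsOptimalSolution n m vs
  walk⇒optimal wk = walk⇒path wk , λ q path → ≤-trans (≤-reflexive (walk-edges wk)) (L≤edges q path)

  optimal⇒walk : ∀ vs → IsOptimalSolution n m vs → Walk (initial n m) L vs
  optimal⇒walk vs (path , shortest) = let us , wk = nonempty 0<k card in
    subst (λ i → Walk (initial n m) i vs)
      (≤-antisym (≤-trans (shortest us (walk⇒path wk)) (≤-reflexive (walk-edges wk))) (L≤edges vs path))
      (path⇒walk vs path)

-- Fibonacci numbers and Binet's formula

F-positive : ∀ k → 0 < F (suc k)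
F-positive zero          = s≤s z≤n
F-positive (suc zero)    = s≤s z≤n
F-positive (suc (suc k)) = m≤n⇒m≤n+o (F (suc k)) (F-positive (suc k))

fromℕ-+ : ∀ j k → + (j ℕ.+ k) ℚ./ 1 ≡ (+ j ℚ./ 1) ℚ.+ (+ k ℚ./ 1)
fromℕ-+ j k = toℚᵘ-injective (begin
  ℚ.toℚᵘ (+ (j ℕ.+ k) ℚ./ 1)                       ≈⟨ toℚᵘ-fromℚᵘ (ℚᵘ.mkℚᵘ (+ (j ℕ.+ k)) 0) ⟩
  ℚᵘ.mkℚᵘ (+ (j ℕ.+ k)) 0
    ≈⟨ ℚᵘ.*≡* (cong (ℤ._* + 1) (sym (cong₂ ℤ._+_ (ℤ.*-identityʳ (+ j)) (ℤ.*-identityʳ (+ k))))) ⟩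
  ℚᵘ.mkℚᵘ (+ j) 0 ℚᵘ.+ ℚᵘ.mkℚᵘ (+ k) 0             ≈⟨ ℚᵘ.+-cong (toℚᵘ-fromℚᵘ (ℚᵘ.mkℚᵘ (+ j) 0)) (toℚᵘ-fromℚᵘ (ℚᵘ.mkℚᵘ (+ k) 0)) ⟨
  ℚ.toℚᵘ (+ j ℚ./ 1) ℚᵘ.+ ℚ.toℚᵘ (+ k ℚ./ 1)       ≈⟨ toℚᵘ-homo-+ (+ j ℚ./ 1) (+ k ℚ./ 1) ⟨
  ℚ.toℚᵘ ((+ j ℚ./ 1) ℚ.+ (+ k ℚ./ 1))             ∎)
  where open ℚᵘ.≃-Reasoning

F-step : ∀ k → + F (suc (suc k)) ℚ./ 1 ≡ (+ F (suc k) ℚ./ 1) ℚ.+ (+ F k ℚ./ 1)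
F-step k = fromℕ-+ (F (suc k)) (F k)

α β : ℚ√5
α = (fromℕ 1 + √5) ÷ fromℕ 2
β = (fromℕ 1 - √5) ÷ fromℕ 2

-- x α + y and x β + y.
_α+_ _β+_ : ℚ → ℚ → ℚ√5
x α+ y = (½ ℚ.* x ℚ.+ y) +√5· (½ ℚ.* x)
x β+ y = (½ ℚ.* x ℚ.+ y) +√5· (ℚ.- ½ ℚ.* x)

private
  5ℚ : ℚ
  5ℚ = + 5 ℚ./ 1

-- The square of `α` is `α` plus one, so multiplication by `α` acts on the coefficients as the
-- Fibonacci recursion.
α-step : ∀ x y → α * (x α+ y) ≡ (x ℚ.+ y) α+ x
α-step x y = cong₂ _+√5·_
  (solve 2 (λ x y → con ½ :* (con ½ :* x :+ y) :+ con 5ℚ :* (con ½ :* (con ½ :* x))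
                 := con ½ :* (x :+ y) :+ x) refl x y)
  (solve 2 (λ x y → con ½ :* (con ½ :* x) :+ con ½ :* (con ½ :* x :+ y)
                 := con ½ :* (x :+ y)) refl x y)
  where open +-*-Solver

β-step : ∀ x y → β * (x β+ y) ≡ (x ℚ.+ y) β+ x
β-step x y = cong₂ _+√5·_
  (solve 2 (λ x y → con ½ :* (con ½ :* x :+ y) :+ con 5ℚ :* (con (ℚ.- ½) :* (con (ℚ.- ½) :* x))
                 := con ½ :* (x :+ y) :+ x) refl x y)
  (solve 2 (λ x y → con ½ :* (con (ℚ.- ½) :* x) :+ con (ℚ.- ½) :* (con ½ :* x :+ y)
                 := con (ℚ.- ½) :* (x :+ y)) refl x y)
  where open +-*-Solver

α-power : ∀ k → α ^ suc k ≡ (+ F (suc k) ℚ./ 1) α+ (+ F k ℚ./ 1)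
α-power zero    = refl
α-power (suc k) = trans (cong (α *_) (α-power k))
  (trans (α-step (+ F (suc k) ℚ./ 1) (+ F k ℚ./ 1)) (cong (_α+ (+ F (suc k) ℚ./ 1)) (sym (F-step k))))

β-power : ∀ k → β ^ suc k ≡ (+ F (suc k) ℚ./ 1) β+ (+ F k ℚ./ 1)
β-power zero    = refl
β-power (suc k) = trans (cong (β *_) (β-power k))
  (trans (β-step (+ F (suc k) ℚ./ 1) (+ F k ℚ./ 1)) (cong (_β+ (+ F (suc k) ℚ./ 1)) (sym (F-step k))))

-- The terms `y` cancel, and `α` and `β` differ by `√5`.
α-β : ∀ x y → (fromℕ 1 ÷ √5) * ((x α+ y) - (x β+ y)) ≡ x +√5· 0ℚ
α-β x y = cong₂ _+√5·_
  (solve 2 (λ x y → con 0ℚ :* ((con ½ :* x :+ y) :- (con ½ :* x :+ y))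
                      :+ con 5ℚ :* (con (+ 1 ℚ./ 5) :* (con ½ :* x :- con (ℚ.- ½) :* x)) := x) refl x y)
  (solve 2 (λ x y → con 0ℚ :* (con ½ :* x :- con (ℚ.- ½) :* x)
                      :+ con (+ 1 ℚ./ 5) :* ((con ½ :* x :+ y) :- (con ½ :* x :+ y)) := con 0ℚ) refl x y)
  where open +-*-Solver

binet : ∀ k → fromℕ (F (suc k)) ≡ (fromℕ 1 ÷ √5) * (α ^ suc k - β ^ suc k)
binet k = sym (trans (cong ((fromℕ 1 ÷ √5) *_) (cong₂ _-_ (α-power k) (β-power k)))
                     (α-β (+ F (suc k) ℚ./ 1) (+ F k ℚ./ 1)))

theorem4 : ∀ (n m : ℕ) → n ≥ m → m ≥ 1 →
    ∃[ φ ] HasCardinality (IsOptimalSolution n m) φ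
    × (m ≡ 1 →
    fromℕ φ ≡ (fromℕ 1 ÷ √5) * (((fromℕ 1 + √5) ÷ fromℕ 2) ^ (n ℕ.+ 2) - ((fromℕ 1 - √5) ÷ fromℕ 2) ^ (n ℕ.+ 2))
    × φ ≡ F (n ℕ.+ 2))
    × (m > 1 → φ ≡ 2)
theorem4 (suc a) 1 _ _ =
  F (suc a ℕ.+ 2)
  , optimal-cardinality (start-live a 0) (F-positive (a ℕ.+ 2)) (count-one a)
  , (λ _ → binet (a ℕ.+ 2) , refl)
  , λ { (s≤s ()) }
-- Here `e` is the surplus of black checkers over white ones.
theorem4 n (suc (suc p)) n≥m _ with e , refl ← m≤n⇒∃[o]m+o≡n n≥m =
  2 , optimal-cardinality (start-live (suc p ℕ.+ e) (suc p)) (s≤s z≤n) count-two , (λ ()) , λ _ → refl
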